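{- For every $n$ there is an instance of $P2\|C_{\max}$ with $3n+1$ jobs and an initial schedule from which a sequence of improving 3-swaps, each interchanging exactly three jobs between the two machines, has length $2^{\Omega(n)}$ before a 3-swap optimal solution is reached; i.e., the number of improving 3-swaps until a 3-swap optimal solution is reached can be $2^{\Omega(n)}$.
   Context: Problem $P2\|C_{\max}$: jobs with processing times $p_j>0$, two identical machines. A schedule $\sigma=(M_1,M_2)$ partitions the jobs into the sets processed on machines 1 and 2; loads $L_i=\sum_{j\in M_i}p_j$, makespan $\max_iL_i$. A 3-swap (in this statement) chooses $k'$ jobs on one machine and $k''$ jobs on the other with $k'+k''=3$ and interchanges their machine assignments; it is improving if the makespan strictly decreases. A 3-swap optimal solution is a schedule admitting no improving 3-swap. -}

module Defs where

open import Data.Bool using (if_then_else_)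
open import Data.Fin using (Fin)
open import Data.Fin.Subset using (Subset; _⊆_; ∁; _─_; _∪_; ∣_∣)
open import Data.Nat as ℕ using (ℕ; zero; suc)
open import Data.Product using (∃; ∃₂; _×_)
open import Data.Rational using (ℚ; 0ℚ; _<_; _⊔_; +-0-rawMonoid)
open import Data.Vec using (lookup)
open import Algebra.Definitions.RawMonoid +-0-rawMonoid using (sum)
open import Relation.Binary.PropositionalEquality using (_≡_)
open import Relation.Nullary using (¬_)

record Instance (m : ℕ) : Set where
  field
    p   : Fin m → ℚ
    p>0 : ∀ j → 0ℚ < p j

-- A schedule (M₁ , M₂) is a partition of the jobs, so it is given by M₁ alone.
record Schedule (m : ℕ) : Set where
  constructor schedule
  field
    M₁ : Subset m

  M₂ : Subset m
  M₂ = ∁ M₁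

open Schedule public

module _ {m : ℕ} (I : Instance m) where
  open Instance I

  load : Subset m → ℚ
  load M = sum (λ j → if lookup M j then p j else 0ℚ)

  makespan : Schedule m → ℚ
  makespan σ = load (M₁ σ) ⊔ load (M₂ σ)

-- K₁ or K₂ may be empty: moving three jobs off one machine is also a 3-swap.
record 3-Swap {m : ℕ} (σ : Schedule m) : Set where
  field
    K₁ K₂ : Subset m
    K₁⊆M₁ : K₁ ⊆ M₁ σ
    K₂⊆M₂ : K₂ ⊆ M₂ σ
    three : ∣ K₁ ∣ ℕ.+ ∣ K₂ ∣ ≡ 3

  result : Schedule m
  result = schedule ((M₁ σ ─ K₁) ∪ K₂)

module _ {m : ℕ} (I : Instance m) where

  Improving : {σ : Schedule m} → 3-Swap σ → Set
  Improving {σ} s = makespan I (3-Swap.result s) < makespan I σ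

  3-SwapOptimal : Schedule m → Set
  3-SwapOptimal σ = ¬ ∃ λ (s : 3-Swap σ) → Improving s

  -- ImprovingSequence σ τ ℓ: a sequence of ℓ improving 3-swaps from σ to τ.
  data ImprovingSequence : Schedule m → Schedule m → ℕ → Set where
    []   : ∀ {σ} → ImprovingSequence σ σ zero
    step : ∀ {σ τ ℓ} (s : 3-Swap σ) → Improving s →
           ImprovingSequence (3-Swap.result s) τ ℓ →
           ImprovingSequence σ τ (suc ℓ)

-- f(n) = 2^Ω(n): for some constant c > 0, f n ≥ 2 ^ (c n) for all large n.
-- By density c may be taken to be a rational a / b, and then the inequality
-- is 2 ^ (a n) ≤ (f n) ^ b.
Is2^Ω[n] : (ℕ → ℕ) → Set
Is2^Ω[n] f =
  ∃₂ λ a b → 0 ℕ.< a × 0 ℕ.< b ×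
  ∃ λ n₀ → ∀ n → n₀ ℕ.≤ n → 2 ℕ.^ (a ℕ.* n) ℕ.≤ f n ℕ.^ b

{-# OPTIONS --safe #-}

-- One job, heavier than all others together, stays on machine 1, so that the makespan
-- is the load of machine 1 and moving any three other jobs is improving as soon as
-- that load decreases. The others form n levels of three jobs; the weights w k of
-- level k satisfy w (k + 1) > 2 (w k). Two jobs of each level act as tokens. Moving a
-- token of level k + 1 off machine 1 pays for moving both tokens of level k back onto
-- it, so each token of level k + 1 buys a complete run of level k and the number of
-- steps doubles from level to level. At level 0 both tokens leave at once, and the
-- third job is toggled to make up three jobs.
module Submission where

open import Defs
open import Data.Nat using (ℕ; _+_; _*_)
open import Data.Product using (Σ-syntax; _×_)

open import Algebra using (CommutativeMonoid)
open import Data.Bool using (true; false; if_then_else_)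
open import Data.Fin using (Fin; zero; suc; funToFin; finToFun)
open import Data.Fin.Induction using (spo-wellFounded)
open import Data.Fin.Properties using (2↔Bool; finToFun-funToFin)
open import Data.Fin.Subset using (Subset; Side; _⊆_; ∁; _─_; _∪_; ∣_∣; ⊤)
open import Data.Fin.Subset.Properties using (_⊆?_; anySubset?; p─q⊆p; out⊆; in⊆in)
open import Data.Nat as ℕ using (zero; suc; _^_; z≤n; s≤s)
import Data.Nat.Properties as ℕ
open import Data.Product using (_,_; ∃; ∃₂; ∃-syntax; proj₁; proj₂)
open import Data.Rational as ℚ using (ℚ; 0ℚ; 1ℚ; _<_; _≤_)
import Data.Rational.Properties as ℚ
open import Data.Vec using ([]; _∷_; lookup; tabulate)
open import Data.Vec.Properties using (tabulate-cong; tabulate∘lookup)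
open import Function using (_∘_; _on_; Inverse)
open import Induction.WellFounded using (WellFounded; Acc; acc; module Subrelation)
import Relation.Binary.Construct.On as On
open import Relation.Binary.PropositionalEquality
  using (_≡_; refl; sym; trans; cong; subst; subst₂; module ≡-Reasoning)
open import Relation.Nullary using (Dec; yes; no)
open import Relation.Nullary.Decidable using (map′; toWitness; _×-dec_)

open import Algebra.Properties.CommutativeSemigroup
  (CommutativeMonoid.commutativeSemigroup ℚ.+-0-commutativeMonoid) using (x∙yz≈y∙xz)

private
  variable
    m d ℓ ℓ′ : ℕ

-- Finiteness: improving 3-swaps terminate.

encode : Subset m → Fin (2 ^ m)
encode M = funToFin (Inverse.from 2↔Bool ∘ lookup M)

decode : Fin (2 ^ m) → Subset m
decode i = tabulate (Inverse.to 2↔Bool ∘ finToFun i)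

decode-encode : (M : Subset m) → decode (encode M) ≡ M
decode-encode M = trans
  (tabulate-cong λ j → trans
    (cong (Inverse.to 2↔Bool) (finToFun-funToFin (Inverse.from 2↔Bool ∘ lookup M) j))
    (Inverse.strictlyInverseˡ 2↔Bool (lookup M j)))
  (tabulate∘lookup M)

-- `_<_` on `ℚ` is not well-founded, but a strict partial order on a finite set is; the coding by
-- `Fin (2 ^ m)` makes this applicable.
subset-wellFounded : (f : Subset m → ℚ) → WellFounded (_<_ on f)
subset-wellFounded f = Subrelation.wellFounded
  (λ {M} {N} → subst₂ (λ X Y → f X < f Y) (sym (decode-encode M)) (sym (decode-encode N)))
  (On.wellFounded encode
    (spo-wellFounded (On.isStrictPartialOrder (f ∘ decode) ℚ.<-isStrictPartialOrder)))

module _ (I : Instance m) where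

  improving? : (σ : Schedule m) → Dec (∃ λ (s : 3-Swap σ) → Improving I s)
  improving? σ = map′ {A = ∃₂ Candidate}
    (λ (K₁ , K₂ , K₁⊆M₁ , K₂⊆M₂ , three , lt) →
      record { K₁ = K₁ ; K₂ = K₂ ; K₁⊆M₁ = K₁⊆M₁ ; K₂⊆M₂ = K₂⊆M₂ ; three = three } , lt)
    (λ (s , lt) → let open 3-Swap s in K₁ , K₂ , K₁⊆M₁ , K₂⊆M₂ , three , lt)
    (anySubset? λ K₁ → anySubset? λ K₂ →
      (K₁ ⊆? M₁ σ) ×-dec (K₂ ⊆? M₂ σ) ×-dec (∣ K₁ ∣ + ∣ K₂ ∣ ℕ.≟ 3) ×-dec
      (makespan I (schedule ((M₁ σ ─ K₁) ∪ K₂)) ℚ.<? makespan I σ))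
    where
    Candidate : Subset m → Subset m → Set
    Candidate K₁ K₂ =
      K₁ ⊆ M₁ σ × K₂ ⊆ M₂ σ × ∣ K₁ ∣ + ∣ K₂ ∣ ≡ 3 ×
      makespan I (schedule ((M₁ σ ─ K₁) ∪ K₂)) < makespan I σ

  -- The explicit run need not end in an optimum. Any improving continuation terminates and only
  -- lengthens the sequence.
  reach-optimal : (σ : Schedule m) →
    ∃₂ λ τ ℓ → ImprovingSequence I σ τ ℓ × 3-SwapOptimal I τ
  reach-optimal σ = go σ (subset-wellFounded (makespan I ∘ schedule) (M₁ σ))
    where
    go : ∀ σ → Acc (_<_ on (makespan I ∘ schedule)) (M₁ σ) →
      ∃₂ λ τ ℓ → ImprovingSequence I σ τ ℓ × 3-SwapOptimal I τ
    go σ (acc rec) with improving? σ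
    ... | no optimal = σ , 0 , [] , optimal
    ... | yes (s , lt) with go (3-Swap.result s) (rec lt)
    ...   | τ , ℓ , seq , optimal = τ , suc ℓ , step s lt seq , optimal

-- Swaps as pairs of subsets with symmetric difference of size 3.

distance : Subset m → Subset m → ℕ
distance M N = ∣ M ─ N ∣ + ∣ N ─ M ∣

distance-refl : (M : Subset m) → distance M M ≡ 0
distance-refl []          = refl
distance-refl (true  ∷ M) = distance-refl M
distance-refl (false ∷ M) = distance-refl M

distance-∷ : (s : Side) (M N : Subset m) → distance (s ∷ M) (s ∷ N) ≡ distance M N
distance-∷ true  M N = refl
distance-∷ false M N = refl

q─p⊆∁p : (p q : Subset m) → q ─ p ⊆ ∁ p
q─p⊆∁p []          []          = λ ()
q─p⊆∁p (true  ∷ p) (_     ∷ q) = out⊆ (q─p⊆∁p p q)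
q─p⊆∁p (false ∷ p) (false ∷ q) = out⊆ (q─p⊆∁p p q)
q─p⊆∁p (false ∷ p) (true  ∷ q) = in⊆in (q─p⊆∁p p q)

swap-differences : (M N : Subset m) → (M ─ (M ─ N)) ∪ (N ─ M) ≡ N
swap-differences []          []          = refl
swap-differences (true  ∷ M) (true  ∷ N) = cong (true  ∷_) (swap-differences M N)
swap-differences (true  ∷ M) (false ∷ N) = cong (false ∷_) (swap-differences M N)
swap-differences (false ∷ M) (true  ∷ N) = cong (true  ∷_) (swap-differences M N)
swap-differences (false ∷ M) (false ∷ N) = cong (false ∷_) (swap-differences M N)

swapTo : (M N : Subset m) → distance M N ≡ 3 → 3-Swap (schedule M)
swapTo M N three = record
  { K₁    = M ─ N
  ; K₂    = N ─ M
  ; K₁⊆M₁ = p─q⊆p M N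
  ; K₂⊆M₂ = q─p⊆∁p M N
  ; three = three
  }

-- Loads and moves, job by job.

addJob : (w : ℚ) → 0ℚ < w → Instance m → Instance (suc m)
addJob w 0<w I = record
  { p   = λ { zero → w   ; (suc j) → Instance.p I j }
  ; p>0 = λ { zero → 0<w ; (suc j) → Instance.p>0 I j }
  }

dropJob : Instance (suc m) → Instance m
dropJob I = record { p = Instance.p I ∘ suc ; p>0 = Instance.p>0 I ∘ suc }

load-nonneg : (I : Instance m) (M : Subset m) → 0ℚ ≤ load I M
load-nonneg I []          = ℚ.≤-refl
load-nonneg I (true  ∷ M) =
  ℚ.+-mono-≤ (ℚ.<⇒≤ (Instance.p>0 I zero)) (load-nonneg (dropJob I) M)
load-nonneg I (false ∷ M) = ℚ.+-mono-≤ ℚ.≤-refl (load-nonneg (dropJob I) M)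

load-≤-⊤ : (I : Instance m) (M : Subset m) → load I M ≤ load I ⊤
load-≤-⊤ I []          = ℚ.≤-refl
load-≤-⊤ I (true  ∷ M) = ℚ.+-monoʳ-≤ (Instance.p I zero) (load-≤-⊤ (dropJob I) M)
load-≤-⊤ I (false ∷ M) =
  ℚ.+-mono-≤ (ℚ.<⇒≤ (Instance.p>0 I zero)) (load-≤-⊤ (dropJob I) M)

p<1+p : ∀ p → p < 1ℚ ℚ.+ p
p<1+p p = subst (_< 1ℚ ℚ.+ p) (ℚ.+-identityˡ p) (ℚ.+-monoˡ-< p (ℚ.positive⁻¹ 1ℚ))

-- Compares loads of machine 1 only: a further job that stays put adds the same amount to both
-- sides, so descents lift through `addJob`.
record Descent (I : Instance m) (M N : Subset m) : Set where
  constructor descent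
  field
    three    : distance M N ≡ 3
    decrease : load I N < load I M

data Descents (I : Instance m) : Subset m → Subset m → ℕ → Set where
  []  : ∀ {M} → Descents I M M 0
  _∷_ : ∀ {L M N} → Descent I L M → Descents I M N ℓ → Descents I L N (suc ℓ)

infixr 5 _++_
_++_ : ∀ {I : Instance m} {L M N} →
  Descents I L M ℓ → Descents I M N ℓ′ → Descents I L N (ℓ + ℓ′)
[]       ++ es = es
(e ∷ ds) ++ es = e ∷ (ds ++ es)

module _ {w : ℚ} {0<w : 0ℚ < w} {I : Instance m} where

  keep : ∀ s {M N} → Descent I M N → Descent (addJob w 0<w I) (s ∷ M) (s ∷ N)
  keep s {M} {N} (descent three decrease) = descent
    (trans (distance-∷ s M N) three)
    (ℚ.+-monoʳ-< (if s then w else 0ℚ) decrease)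

  keeps : ∀ s {M N} → Descents I M N ℓ → Descents (addJob w 0<w I) (s ∷ M) (s ∷ N) ℓ
  keeps s []       = []
  keeps s (e ∷ es) = keep s e ∷ keeps s es

-- An incomplete move, which may raise the load; `lower` completes two flips to a descent by
-- removing a job heavier than `δ`.
record Shift (I : Instance m) (M N : Subset m) (d : ℕ) (δ : ℚ) : Set where
  constructor shift
  field
    flips : distance M N ≡ d
    gain  : load I N ≡ δ ℚ.+ load I M

shift-refl : (I : Instance m) (M : Subset m) → Shift I M M 0 0ℚ
shift-refl I M = shift (distance-refl M) (sym (ℚ.+-identityˡ (load I M)))

module _ {w : ℚ} {0<w : 0ℚ < w} {I : Instance m} {M N : Subset m} {δ : ℚ}
         (S : Shift I M N d δ) where
  open Shift S

  shift-keep : ∀ s → Shift (addJob w 0<w I) (s ∷ M) (s ∷ N) d δ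
  shift-keep s = shift
    (trans (distance-∷ s M N) flips)
    (trans (cong (v ℚ.+_) gain)
           (x∙yz≈y∙xz v δ (load I M)))
    where v = if s then w else 0ℚ

  shift-raise : Shift (addJob w 0<w I) (false ∷ M) (true ∷ N) (suc d) (w ℚ.+ δ)
  shift-raise = shift
    (trans (ℕ.+-suc ∣ M ─ N ∣ ∣ N ─ M ∣) (cong suc flips))
    (begin
      w ℚ.+ load I N                   ≡⟨ cong (w ℚ.+_) gain ⟩
      w ℚ.+ (δ ℚ.+ load I M)           ≡⟨ ℚ.+-assoc w δ (load I M) ⟨
      (w ℚ.+ δ) ℚ.+ load I M           ≡⟨ cong ((w ℚ.+ δ) ℚ.+_) (ℚ.+-identityˡ (load I M)) ⟨
      (w ℚ.+ δ) ℚ.+ (0ℚ ℚ.+ load I M)  ∎)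
    where open ≡-Reasoning

lower : ∀ {w} {0<w : 0ℚ < w} {I : Instance m} {M N δ} →
  Shift I M N 2 δ → δ < w → Descent (addJob w 0<w I) (true ∷ M) (false ∷ N)
lower {w = w} {I = I} {M} {N} {δ} (shift flips gain) δ<w = descent (cong suc flips)
  (subst (_< w ℚ.+ load I M) (sym (trans (ℚ.+-identityˡ (load I N)) gain))
         (ℚ.+-monoˡ-< (load I M) δ<w))

-- The levels and their recursive run.

weight : ℕ → ℚ
weight zero    = 1ℚ
weight (suc k) = 1ℚ ℚ.+ (weight k ℚ.+ (weight k ℚ.+ 0ℚ))

weight>0 : ∀ k → 0ℚ < weight k
weight>0 zero    = ℚ.positive⁻¹ 1ℚ
weight>0 (suc k) = ℚ.<-trans
  (ℚ.+-mono-< (weight>0 k) (ℚ.+-mono-<-≤ (weight>0 k) ℚ.≤-refl))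
  (p<1+p _)

levels : ∀ n → Instance (n * 3)
levels zero    = record { p = λ () ; p>0 = λ () }
levels (suc k) = add (add (add (levels k)))
  where
  add : ∀ {m} → Instance m → Instance (suc m)
  add = addJob (weight k) (weight>0 k)

-- Levels are listed from the top; b is the position of the toggled job of level 0.
spent : ∀ k → Side → Subset (suc (k * 3))
spent zero    b = b ∷ []
spent (suc k) b = false ∷ false ∷ false ∷ spent k b

-- `spent (suc k) b` computes to `false ∷ idle k b`, so `idle k b` sits literally inside both states
-- of level `suc k`.
idle armed : ∀ k → Side → Subset (suc k * 3)
idle  k b = false ∷ false ∷ spent k b
armed k b = true  ∷ true  ∷ spent k b

-- The gain keeps its `0ℚ` so that `weight (suc k)` is by definition 1 plus this gain.
arm : ∀ k b → Shift (levels (suc k)) (idle k b) (armed k b) 2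
                    (weight k ℚ.+ (weight k ℚ.+ 0ℚ))
arm k b = shift-raise (shift-raise (shift-refl _ (spent k b)))

runLength : ℕ → ℕ
runLength zero    = 1
runLength (suc k) = suc (runLength k + suc (runLength k))

-- Each base step toggles the last job; the existential `c` avoids tracking the parity.
run : ∀ k b → ∃[ c ] Descents (levels (suc k)) (armed k b) (idle k c) (runLength k)
-- The load drops from 2 to 1 here, and from 3 to 0 in the next clause.
run zero false = true  , descent refl (toWitness {a? = _ ℚ.<? _} _) ∷ []
run zero true  = false , descent refl (toWitness {a? = _ ℚ.<? _} _) ∷ []
run (suc k) b with run k b
... | c , es with run k c
...   | c′ , es′ = c′ ,
  -- The first token of level `suc k` leaves and re-arms level `k`.
  lower (shift-keep (shift-keep (arm k b) false) true) (p<1+p _) ∷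
  (keeps false (keeps true (keeps false es)) ++
   -- The second token re-arms level `k` from where the first run stopped.
   keep false (lower (shift-keep (arm k c) false) (p<1+p _)) ∷
   keeps false (keeps false (keeps false es′)))

-- The heavy job: from loads to makespans.

module _ {I : Instance m} {w : ℚ} {0<w : 0ℚ < w} (heavy : load I ⊤ ≤ w) where

  private
    J : Instance (suc m)
    J = addJob w 0<w I

  -- All the jobs of `I` together weigh at most `w`, so machine 2 never dominates.
  makespan-heavy : (M : Subset m) → makespan J (schedule (true ∷ M)) ≡ load J (true ∷ M)
  makespan-heavy M = ℚ.p≥q⇒p⊔q≡p (begin
    0ℚ ℚ.+ load I (∁ M)  ≡⟨ ℚ.+-identityˡ _ ⟩
    load I (∁ M)         ≤⟨ load-≤-⊤ I (∁ M) ⟩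
    load I ⊤             ≤⟨ heavy ⟩
    w                    ≡⟨ ℚ.+-identityʳ w ⟨
    w ℚ.+ 0ℚ             ≤⟨ ℚ.+-monoʳ-≤ w (load-nonneg I M) ⟩
    w ℚ.+ load I M       ∎)
    where open ℚ.≤-Reasoning

  descents⇒improving : ∀ {M N τ} → Descents I M N ℓ →
    ImprovingSequence J (schedule (true ∷ N)) τ ℓ′ →
    ImprovingSequence J (schedule (true ∷ M)) τ (ℓ + ℓ′)
  descents⇒improving [] seq = seq
  descents⇒improving {ℓ′ = ℓ′} {M = L} {τ = τ} (_∷_ {ℓ = ℓ} {M = M} (descent three decrease) es) seq =
    step s
      (subst (λ X → makespan J (schedule X) < makespan J (schedule (true ∷ L)))
        (sym target)
        (subst₂ _<_ (sym (makespan-heavy M)) (sym (makespan-heavy L))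
          (ℚ.+-monoʳ-< w decrease)))
      (subst (λ X → ImprovingSequence J (schedule X) τ (ℓ + ℓ′)) (sym target)
        (descents⇒improving es seq))
    where
    s      = swapTo (true ∷ L) (true ∷ M) three
    target = swap-differences (true ∷ L) (true ∷ M)

-- Counting the steps.

LongRun : ℕ → ℕ → Set
LongRun ℓ₀ m =
  Σ[ ℓ ∈ ℕ ] ℓ₀ ℕ.≤ ℓ × Σ[ I ∈ Instance m ] Σ[ σ ∈ Schedule m ] Σ[ τ ∈ Schedule m ]
    ImprovingSequence I σ τ ℓ × 3-SwapOptimal I τ

descents⇒longRun : ∀ {I : Instance m} {M N} → Descents I M N ℓ → LongRun ℓ (suc m)
descents⇒longRun {ℓ = ℓ} {I = I} {N = N} es =
  let τ , ℓ′ , seq , optimal = reach-optimal J (schedule (true ∷ N))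
  in  ℓ + ℓ′ , ℕ.m≤m+n ℓ ℓ′ , J , _ , τ ,
      descents⇒improving (ℚ.<⇒≤ (p<1+p _)) es seq , optimal
  where
  J = addJob (1ℚ ℚ.+ load I ⊤) (ℚ.≤-<-trans (load-nonneg I ⊤) (p<1+p _)) I

bound : ℕ → ℕ
bound zero    = 0
bound (suc k) = runLength k

longRun : ∀ n → LongRun (bound n) (3 * n + 1)
longRun n = subst (LongRun (bound n))
  (trans (ℕ.+-comm 1 (n * 3)) (cong (_+ 1) (ℕ.*-comm n 3)))
  (run′ n)
  where
  run′ : ∀ n → LongRun (bound n) (suc (n * 3))
  run′ zero    = descents⇒longRun {I = levels 0} {M = []} []
  run′ (suc k) = descents⇒longRun (proj₂ (run k false))

-- In closed form `runLength k` is 3 * 2 ^ k - 2. The induction starts at `runLength 1`, where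
-- equality holds.
2^[2+k]≤runLength : ∀ k → 2 ^ (2 + k) ℕ.≤ runLength (suc k)
2^[2+k]≤runLength zero    = ℕ.≤-refl
2^[2+k]≤runLength (suc k) = begin
  2 ^ (2 + k) + (2 ^ (2 + k) + 0)  ≡⟨ cong (2 ^ (2 + k) +_) (ℕ.+-identityʳ _) ⟩
  2 ^ (2 + k) + 2 ^ (2 + k)        ≤⟨ ℕ.+-mono-≤ ih (ℕ.m≤n⇒m≤1+n ih) ⟩
  r + suc r                        ≤⟨ ℕ.n≤1+n _ ⟩
  suc (r + suc r)                  ∎
  where
  open ℕ.≤-Reasoning
  r  = runLength (suc k)
  ih = 2^[2+k]≤runLength k

2^n≤bound : ∀ n → 2 ℕ.≤ n → 2 ^ n ℕ.≤ bound n
2^n≤bound (suc (suc k)) _ = 2^[2+k]≤runLength k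
2^n≤bound (suc zero) (s≤s ())

theorem5 : Σ[ ℓ ∈ (ℕ → ℕ) ] Is2^Ω[n] ℓ ×
    (∀ (n : ℕ) →
    Σ[ I ∈ Instance (3 * n + 1) ]
    Σ[ σ ∈ Schedule (3 * n + 1) ]
    Σ[ τ ∈ Schedule (3 * n + 1) ]
    ImprovingSequence I σ τ (ℓ n) × 3-SwapOptimal I τ)
theorem5 =
  (λ n → proj₁ (longRun n)) ,
  -- The exponent constant is 1/1. The threshold is 2 because `bound` is 0 at 0 and 1 at 1, below 2
  -- ^ n.
  (1 , 1 , s≤s z≤n , s≤s z≤n , 2 , exponential) ,
  (λ n → proj₂ (proj₂ (longRun n)))
  where
  exponential : ∀ n → 2 ℕ.≤ n → 2 ^ (1 * n) ℕ.≤ proj₁ (longRun n) ^ 1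
  exponential n 2≤n = begin
    2 ^ (1 * n)             ≡⟨ cong (2 ^_) (ℕ.*-identityˡ n) ⟩
    2 ^ n                   ≤⟨ 2^n≤bound n 2≤n ⟩
    bound n                 ≤⟨ proj₁ (proj₂ (longRun n)) ⟩
    proj₁ (longRun n)       ≡⟨ ℕ.^-identityʳ _ ⟨
    proj₁ (longRun n) ^ 1   ∎
    where open ℕ.≤-Reasoning
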